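{- Any deterministic random-order-model algorithm for the (general or proportional) knapsack problem that does not revoke has competitive ratio $\Omega(n)$.
   Context: Knapsack problem: a knapsack has a capacity known to the algorithm in advance. Items $(v_1,w_1),\dots,(v_n,w_n)$, with value $v_i\ge0$ and weight $w_i\ge0$, arrive online one at a time, each revealed on arrival; $n$ is the number of items. The total weight of packed items may not exceed the capacity, and the objective is to maximize the total value packed. The proportional knapsack problem is the special case $v_i=w_i$ for all $i$; the general problem has no such restriction. An algorithm that does not revoke must irrevocably decide whether to pack each item upon its arrival, before the next item arrives. Random-order model (ROM): an adversary chooses a multiset of items, which arrive in the order of a uniformly random permutation. With $\mathrm{Opt}$ the optimal offline value and $\mathbb{E}[\mathrm{Alg}]$ the expected value packed by the algorithm over the random permutation, a competitive ratio $\rho$ means $\mathrm{Opt}\le\rho\,\mathbb{E}[\mathrm{Alg}]+o(\mathrm{Opt})$. -}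

module Defs where

open import Data.Bool.Base using (Bool; true; false; if_then_else_)
open import Data.Integer.Base using (+_)
open import Data.List.Base using (List; []; _∷_; _++_; map; concatMap; foldr; filter; length)
open import Data.Nat.Base as ℕ using (ℕ; suc)
open import Data.Product.Base using (Σ-syntax; ∃-syntax; _×_)
open import Data.Rational using (ℚ; 0ℚ; _/_; _+_; _*_; _≤_; _<_; _⊔_; ∣_∣; _≤?_)
open import Data.Unit.Base using (⊤)
open import Relation.Binary.PropositionalEquality using (_≡_)

data Problem : Set where
  general proportional : Problem

Admissible : Problem → ℚ → ℚ → Set
Admissible general      v w = ⊤
Admissible proportional v w = v ≡ w

record Item (P : Problem) : Set where
  field
    value      : ℚ
    weight     : ℚ
    0≤value    : 0ℚ ≤ value
    0≤weight   : 0ℚ ≤ weight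
    admissible : Admissible P value weight

open Item public

sumℚ : List ℚ → ℚ
sumℚ = foldr _+_ 0ℚ

totalValue totalWeight : ∀ {P} → List (Item P) → ℚ
totalValue  xs = sumℚ (map value xs)
totalWeight xs = sumℚ (map weight xs)

-- The list of items represents the adversary's multiset; its order is immaterial.
-- The capacity belongs to the input: with a single fixed capacity, Opt would be bounded
-- in the proportional problem and an additive o(Opt) would be meaningless.
record Instance (P : Problem) : Set where
  field
    capacity   : ℚ
    0<capacity : 0ℚ < capacity
    items      : List (Item P)

open Instance public

size : ∀ {P} → Instance P → ℕ
size I = length (items I)

subcollections : ∀ {A : Set} → List A → List (List A)
subcollections []       = [] ∷ []
subcollections (x ∷ xs) = subcollections xs ++ map (x ∷_) (subcollections xs)

-- The empty collection is always feasible and values are nonnegative, so 0ℚ is a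
-- neutral starting point for the maximum.
Opt : ∀ {P} → Instance P → ℚ
Opt I = foldr _⊔_ 0ℚ (map totalValue
  (filter (λ S → totalWeight S ≤? capacity I) (subcollections (items I))))

-- `accept C past x` is the decision on the arriving item x, where `past` lists the items
-- that arrived earlier, most recent first. Earlier decisions are determined by `past`, so
-- they are not a separate argument. The number of items still to come is not an argument.
Rule : Problem → Set
Rule P = (C : ℚ) (past : List (Item P)) (x : Item P) → Bool

packedAfter : ∀ {P} → Rule P → ℚ → (past future : List (Item P)) → List (Item P)
packedAfter accept C past []       = []
packedAfter accept C past (x ∷ xs) =
  if accept C past x
  then x ∷ packedAfter accept C (x ∷ past) xs
  else packedAfter accept C (x ∷ past) xs

packed : ∀ {P} → Rule P → ℚ → List (Item P) → List (Item P)
packed accept C xs = packedAfter accept C [] xs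

record Algorithm (P : Problem) : Set where
  field
    accept   : Rule P
    feasible : ∀ C → 0ℚ < C → ∀ xs → totalWeight (packed accept C xs) ≤ C

open Algorithm public

insertions : ∀ {A : Set} → A → List A → List (List A)
insertions x []       = (x ∷ []) ∷ []
insertions x (y ∷ ys) = (x ∷ y ∷ ys) ∷ map (y ∷_) (insertions x ys)

-- All n! arrangements of the positions of a list of length n; equal entries are treated
-- as distinguishable, so averaging over this list is averaging over the permutations.
arrangements : ∀ {A : Set} → List A → List (List A)
arrangements []       = [] ∷ []
arrangements (x ∷ xs) = concatMap (insertions x) (arrangements xs)

mean : List ℚ → ℚ
mean []           = 0ℚ
mean qs@(_ ∷ qs′) = sumℚ qs * (+ 1 / suc (length qs′))

𝔼Alg : ∀ {P} → Algorithm P → Instance P → ℚ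
𝔼Alg A I = mean (map (λ xs → totalValue (packed (accept A) (capacity I) xs))
                     (arrangements (items I)))

-- g(x) = o(x) as x → ∞
Sublinear : (ℚ → ℚ) → Set
Sublinear g = ∀ δ → 0ℚ < δ → ∃[ M ] (∀ x → M ≤ x → ∣ g x ∣ ≤ δ * x)

CompetitiveAt : ∀ {P} → Algorithm P → ℕ → ℚ → Set
CompetitiveAt {P} A n ρ =
  Σ[ g ∈ (ℚ → ℚ) ] Sublinear g ×
    ((I : Instance P) → size I ≡ n → Opt I ≤ ρ * 𝔼Alg A I + g (Opt I))

-- Finitely many n are disregarded, so an algorithm that is not competitive
-- on very short inputs may still have a competitive ratio as a function of n.
HasCompetitiveRatio : ∀ {P} → Algorithm P → (ℕ → ℚ) → Set
HasCompetitiveRatio A ρ = ∃[ n₀ ] (∀ n → n₀ ℕ.≤ n → CompetitiveAt A n (ρ n))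

_∈Ω_ : (ℕ → ℚ) → (ℕ → ℚ) → Set
f ∈Ω g = ∃[ c ] (0ℚ < c × ∃[ N ] (∀ n → N ℕ.≤ n → c * g n ≤ f n))

-- Let the algorithm be competitive for every length at least n₀, and put m = n₀ + 1. On m
-- copies of one heavy item it must pack a copy, since otherwise it gains nothing while Opt is
-- unbounded. Now mix n − 1 such items with a single item that fills the whole capacity C,
-- where C is at least n² times their weight. Unless the large item is among the first m
-- arrivals, a small item is packed before it and blocks it, and the gain is at most C / n.
-- So the expected gain is at most (m + 1) C / n, while Opt ≥ C.
module Submission where

open import Defs
open import Data.Bool.Base using (true; false)
open import Data.Empty using (⊥-elim)
open import Data.Integer.Base as ℤ using (+_)
import Data.Integer.Properties as ℤ
open import Data.List.Base using (List; []; _∷_; _++_; map; concatMap; foldr; length; replicate)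
open import Data.List.Membership.Propositional using (_∈_)
open import Data.List.Membership.Propositional.Properties
  using (∈-map⁺; ∈-filter⁺; ∈-++⁺ˡ; ∈-++⁺ʳ)
open import Data.List.Properties
  using (map-++; map-∘; length-++; length-map; length-replicate; foldr-forcesᵇ)
open import Data.List.Relation.Binary.Permutation.Propositional
  using (_↭_; prep; swap; ↭-refl; ↭-trans; ↭-sym)
open import Data.List.Relation.Binary.Permutation.Propositional.Properties
  using (All-resp-↭; ↭-length)
open import Data.List.Relation.Unary.All as All using (All; []; _∷_)
import Data.List.Relation.Unary.All.Properties as All
open import Data.List.Relation.Unary.Any using (here)
open import Data.Nat.Base as ℕ using (ℕ; zero; suc)
import Data.Nat.Properties as ℕ
open import Data.Product.Base using (_,_; ∃-syntax; _×_; proj₁; proj₂)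
open import Data.Rational
  using (ℚ; 0ℚ; 1ℚ; ½; _/_; _+_; _*_; _≤_; _<_; _⊔_; ∣_∣; -_;
         positive; nonNegative; toℚᵘ)
open import Data.Rational.Properties
open import Data.Rational.Solver using (module +-*-Solver)
import Data.Rational.Unnormalised.Base as ℚᵘ
import Data.Rational.Unnormalised.Properties as ℚᵘ
open import Data.Sum.Base using (_⊎_; inj₁; inj₂)
open import Data.Unit.Base using (tt)
open import Function.Base using (_∘_)
open import Relation.Binary.PropositionalEquality
  using (_≡_; _≢_; refl; sym; trans; cong; cong₂; subst; subst₂)

open +-*-Solver using (solve; _:+_; _:*_; _:=_; con)

-- Natural numbers as rationals, and order lemmas.

ι : ℕ → ℚ
ι n = + n / 1

-- Unnormalised rationals do not reduce fractions, so there the claim is an identity of integer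
-- numerators over the denominator 1. It is carried back by injectivity of `toℚᵘ`.
ι-+ : ∀ a b → ι (a ℕ.+ b) ≡ ι a + ι b
ι-+ a b = toℚᵘ-injective (begin
  toℚᵘ (ι (a ℕ.+ b))                        ≈⟨ toℚᵘ-fromℚᵘ (ιᵘ (a ℕ.+ b)) ⟩
  ιᵘ (a ℕ.+ b)                              ≈⟨ ιᵘ-+ ⟩
  ιᵘ a ℚᵘ.+ ιᵘ b                            ≈⟨ ℚᵘ.+-cong (toℚᵘ-fromℚᵘ (ιᵘ a)) (toℚᵘ-fromℚᵘ (ιᵘ b)) ⟨
  toℚᵘ (ι a) ℚᵘ.+ toℚᵘ (ι b)                ≈⟨ toℚᵘ-homo-+ (ι a) (ι b) ⟨
  toℚᵘ (ι a + ι b)                          ∎)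
  where
  open ℚᵘ.≃-Reasoning
  ιᵘ : ℕ → ℚᵘ.ℚᵘ
  ιᵘ n = ℚᵘ.mkℚᵘ (+ n) 0
  ιᵘ-+ : ιᵘ (a ℕ.+ b) ℚᵘ.≃ ιᵘ a ℚᵘ.+ ιᵘ b
  ιᵘ-+ = ℚᵘ.*≡* (cong (ℤ._* + 1)
    (sym (cong₂ ℤ._+_ (ℤ.*-identityʳ (+ a)) (ℤ.*-identityʳ (+ b)))))

ι-*-inverse : ∀ n → ι (suc n) * (+ 1 / suc n) ≡ 1ℚ
ι-*-inverse n = toℚᵘ-injective (begin
  toℚᵘ (ι (suc n) * (+ 1 / suc n))           ≈⟨ toℚᵘ-homo-* (ι (suc n)) (+ 1 / suc n) ⟩
  toℚᵘ (ι (suc n)) ℚᵘ.* toℚᵘ (+ 1 / suc n)   ≈⟨ ℚᵘ.*-cong (toℚᵘ-fromℚᵘ (ℚᵘ.mkℚᵘ (+ suc n) 0))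
                                                          (toℚᵘ-fromℚᵘ (ℚᵘ.mkℚᵘ (+ 1) n)) ⟩
  ℚᵘ.mkℚᵘ (+ suc n) 0 ℚᵘ.* ℚᵘ.mkℚᵘ (+ 1) n   ≈⟨ ℚᵘ.*≡* (trans (ℤ.*-identityʳ _)
                                                  (trans (ℤ.*-identityʳ (+ suc n))
                                                  (sym (trans (ℤ.*-identityˡ _) (cong (λ k → + suc k) (ℕ.+-identityʳ n)))))) ⟩
  ℚᵘ.1ℚᵘ                                     ∎)
  where open ℚᵘ.≃-Reasoning

0≤ι : ∀ n → 0ℚ ≤ ι n
0≤ι n = nonNegative⁻¹ (ι n) {{normalize-nonNeg n 1}}

0<1/suc : ∀ n → 0ℚ < + 1 / suc n
0<1/suc n = positive⁻¹ (+ 1 / suc n) {{normalize-pos 1 (suc n)}}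

*-monoˡ-≤ : ∀ {r p q} → 0ℚ ≤ r → p ≤ q → r * p ≤ r * q
*-monoˡ-≤ {r} 0≤r = *-monoˡ-≤-nonNeg r {{nonNegative 0≤r}}

*-monoʳ-≤ : ∀ {r p q} → 0ℚ ≤ r → p ≤ q → p * r ≤ q * r
*-monoʳ-≤ {r} 0≤r = *-monoʳ-≤-nonNeg r {{nonNegative 0≤r}}

p≤p+q : ∀ {p q} → 0ℚ ≤ q → p ≤ p + q
p≤p+q {p} {q} 0≤q = subst (_≤ p + q) (+-identityʳ p) (+-monoʳ-≤ p 0≤q)

p≤q+p : ∀ {p q} → 0ℚ ≤ q → p ≤ q + p
p≤q+p {p} {q} 0≤q = subst (p ≤_) (+-comm p q) (p≤p+q 0≤q)

ι-mono-≤ : ∀ {a b} → a ℕ.≤ b → ι a ≤ ι b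
ι-mono-≤ {a} a≤b with d , refl ← ℕ.m≤n⇒∃[o]m+o≡n a≤b =
  subst (ι a ≤_) (sym (ι-+ a d)) (p≤p+q (0≤ι d))

ι-suc-* : ∀ n c → ι (suc n) * c ≡ c + ι n * c
ι-suc-* n c = trans (cong (_* c) (ι-+ 1 n))
  (solve 2 (λ i c → (con 1ℚ :+ i) :* c := c :+ i :* c) refl (ι n) c)

-- Sums and means.

sumℚ-++ : ∀ ps qs → sumℚ (ps ++ qs) ≡ sumℚ ps + sumℚ qs
sumℚ-++ []       qs = sym (+-identityˡ _)
sumℚ-++ (p ∷ ps) qs = trans (cong (_+_ p) (sumℚ-++ ps qs)) (sym (+-assoc p _ _))

0≤sumℚ : ∀ {qs} → All (0ℚ ≤_) qs → 0ℚ ≤ sumℚ qs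
0≤sumℚ []           = ≤-refl
0≤sumℚ (0≤q ∷ 0≤qs) = +-mono-≤ 0≤q (0≤sumℚ 0≤qs)

All-≤-sumℚ : ∀ {qs} → All (0ℚ ≤_) qs → All (_≤ sumℚ qs) qs
All-≤-sumℚ []           = []
All-≤-sumℚ (0≤q ∷ 0≤qs) =
  p≤p+q (0≤sumℚ 0≤qs) ∷ All.map (λ p≤s → ≤-trans p≤s (p≤q+p 0≤q)) (All-≤-sumℚ 0≤qs)

sumℚ-≤ : ∀ {c qs} → All (_≤ c) qs → sumℚ qs ≤ ι (length qs) * c
sumℚ-≤ {c} []                      = ≤-reflexive (sym (*-zeroˡ c))
sumℚ-≤ {c} (_∷_ {xs = qs} q≤c qs≤c) =
  ≤-trans (+-mono-≤ q≤c (sumℚ-≤ qs≤c)) (≤-reflexive (sym (ι-suc-* (length qs) c)))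

sumℚ-map-≤ : ∀ {A : Set} {f : A → ℚ} {c xs} →
  All (λ x → f x ≤ c) xs → sumℚ (map f xs) ≤ ι (length xs) * c
sumℚ-map-≤ {f = f} {c} {xs} fxs≤c =
  subst (λ n → sumℚ (map f xs) ≤ ι n * c) (length-map f xs) (sumℚ-≤ (All.map⁺ fxs≤c))

-- Bounds on block averages combine into a bound on the overall average, whatever the block lengths.
-- For `arrangements`, a block is the list of insertions of the first item into one arrangement of
-- the others.
sumℚ-concatMap-≤ : ∀ {A B : Set} (f : B → ℚ) (g : A → List B) {c xs} →
  All (λ x → sumℚ (map f (g x)) ≤ ι (length (g x)) * c) xs →
  sumℚ (map f (concatMap g xs)) ≤ ι (length (concatMap g xs)) * c
sumℚ-concatMap-≤ f g {c} [] = ≤-reflexive (sym (*-zeroˡ c))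
sumℚ-concatMap-≤ f g {c} (_∷_ {x = x} {xs = xs} h hs) = begin
  sumℚ (map f (g x ++ rest))                   ≡⟨ cong sumℚ (map-++ f (g x) rest) ⟩
  sumℚ (map f (g x) ++ map f rest)             ≡⟨ sumℚ-++ (map f (g x)) (map f rest) ⟩
  sumℚ (map f (g x)) + sumℚ (map f rest)       ≤⟨ +-mono-≤ h (sumℚ-concatMap-≤ f g hs) ⟩
  ι (length (g x)) * c + ι (length rest) * c   ≡⟨ *-distribʳ-+ c (ι (length (g x))) (ι (length rest)) ⟨
  (ι (length (g x)) + ι (length rest)) * c     ≡⟨ cong (_* c) (ι-+ (length (g x)) (length rest)) ⟨
  ι (length (g x) ℕ.+ length rest) * c         ≡⟨ cong (λ n → ι n * c) (length-++ (g x)) ⟨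
  ι (length (g x ++ rest)) * c                 ∎
  where
  open ≤-Reasoning
  rest = concatMap g xs

mean-≤ : ∀ {c} qs → 0ℚ ≤ c → sumℚ qs ≤ ι (length qs) * c → mean qs ≤ c
-- The mean of the empty list is `0ℚ` by convention, hence the hypothesis `0ℚ ≤ c`.
mean-≤ []           0≤c _ = 0≤c
mean-≤ {c} (q ∷ qs) _   h = begin
  sumℚ (q ∷ qs) * r                ≤⟨ *-monoʳ-≤ (<⇒≤ (0<1/suc (length qs))) h ⟩
  ι (suc (length qs)) * c * r      ≡⟨ solve 3 (λ i c r → i :* c :* r := (i :* r) :* c) refl (ι (suc (length qs))) c r ⟩
  ι (suc (length qs)) * r * c      ≡⟨ cong (_* c) (ι-*-inverse (length qs)) ⟩
  1ℚ * c                           ≡⟨ *-identityˡ c ⟩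
  c                                ∎
  where
  open ≤-Reasoning
  r = + 1 / suc (length qs)

0≤mean : ∀ {qs} → All (0ℚ ≤_) qs → 0ℚ ≤ mean qs
0≤mean []                        = ≤-refl
0≤mean {q ∷ qs} 0≤qs@(_ ∷ _) =
  subst (_≤ mean (q ∷ qs)) (*-zeroˡ (+ 1 / suc (length qs)))
    (*-monoʳ-≤ (<⇒≤ (0<1/suc (length qs))) (0≤sumℚ 0≤qs))

-- Insertions and arrangements.

insertions-↭ : ∀ {A : Set} (x : A) ys → All (_↭ x ∷ ys) (insertions x ys)
insertions-↭ x []       = ↭-refl ∷ []
insertions-↭ x (y ∷ ys) = ↭-refl ∷
  All.map⁺ (All.map (λ σ → ↭-trans (prep y σ) (swap y x ↭-refl)) (insertions-↭ x ys))

length-insertions : ∀ {A : Set} (x : A) ys → length (insertions x ys) ≡ suc (length ys)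
length-insertions x []       = refl
length-insertions x (y ∷ ys) =
  cong suc (trans (length-map (y ∷_) (insertions x ys)) (length-insertions x ys))

arrangements-↭ : ∀ {A : Set} (xs : List A) → All (_↭ xs) (arrangements xs)
arrangements-↭ []       = ↭-refl ∷ []
arrangements-↭ (x ∷ xs) = All.concat⁺ (All.map⁺ (All.map
  (λ {ys} σ → All.map (λ τ → ↭-trans τ (prep x σ)) (insertions-↭ x ys))
  (arrangements-↭ xs)))

All-≡⇒replicate : ∀ {A : Set} {x : A} {xs} → All (_≡ x) xs → xs ≡ replicate (length xs) x
All-≡⇒replicate []          = refl
All-≡⇒replicate (refl ∷ eqs) = cong (_ ∷_) (All-≡⇒replicate eqs)

-- A permutation keeps both the length and the property that every entry is `x`, and these two
-- determine the list.
arrangements-replicate : ∀ {A : Set} n (x : A) →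
  All (_≡ replicate n x) (arrangements (replicate n x))
arrangements-replicate n x = All.map
  (λ σ → trans (All-≡⇒replicate (All-resp-↭ (↭-sym σ) (All.replicate⁺ n refl)))
               (cong (λ k → replicate k x) (trans (↭-length σ) (length-replicate n))))
  (arrangements-↭ (replicate n x))

replicate-+ : ∀ {A : Set} a b (x : A) → replicate (a ℕ.+ b) x ≡ replicate a x ++ replicate b x
replicate-+ zero    b x = refl
replicate-+ (suc a) b x = cong (x ∷_) (replicate-+ a b x)

-- Only the length us insertions that put x inside us escape the bound l.
sumℚ-insertions-≤ : ∀ {A : Set} (f : List A → ℚ) {h l x} us vs →
  All (λ zs → f zs ≤ h) (insertions x (us ++ vs)) →
  All (λ zs → f (us ++ zs) ≤ l) (insertions x vs) →
  sumℚ (map f (insertions x (us ++ vs))) ≤ ι (length us) * h + ι (suc (length vs)) * l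
sumℚ-insertions-≤ f {h} {l} {x} [] vs _ late = begin
  sumℚ (map f (insertions x vs))           ≤⟨ sumℚ-map-≤ late ⟩
  ι (length (insertions x vs)) * l         ≡⟨ cong (λ n → ι n * l) (length-insertions x vs) ⟩
  ι (suc (length vs)) * l                  ≡⟨ +-identityˡ _ ⟨
  0ℚ + ι (suc (length vs)) * l             ≡⟨ cong (_+ ι (suc (length vs)) * l) (*-zeroˡ h) ⟨
  ι 0 * h + ι (suc (length vs)) * l        ∎
  where open ≤-Reasoning
sumℚ-insertions-≤ f {h} {l} {x} (u ∷ us) vs (fzs≤h ∷ early) late = begin
  f (x ∷ u ∷ us ++ vs) + sumℚ (map f (map (u ∷_) (insertions x (us ++ vs))))
    ≡⟨ cong (λ qs → f (x ∷ u ∷ us ++ vs) + sumℚ qs) (map-∘ {g = f} {f = u ∷_} (insertions x (us ++ vs))) ⟨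
  f (x ∷ u ∷ us ++ vs) + sumℚ (map (f ∘ (u ∷_)) (insertions x (us ++ vs)))
    ≤⟨ +-mono-≤ fzs≤h (sumℚ-insertions-≤ (f ∘ (u ∷_)) us vs (All.map⁻ early) late) ⟩
  h + (ι (length us) * h + ι (suc (length vs)) * l)
    ≡⟨ +-assoc h _ _ ⟨
  h + ι (length us) * h + ι (suc (length vs)) * l
    ≡⟨ cong (_+ ι (suc (length vs)) * l) (ι-suc-* (length us) h) ⟨
  ι (suc (length us)) * h + ι (suc (length vs)) * l ∎
  where open ≤-Reasoning

-- Lower bounds on the optimum.

≤-foldr-⊔ : ∀ {q} qs → q ∈ qs → q ≤ foldr _⊔_ 0ℚ qs
-- The maximum is at most itself, and an upper bound on `p ⊔ q` passes to both `p` and `q`;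
-- descending through the fold, it reaches every entry.
≤-foldr-⊔ qs = All.lookup (foldr-forcesᵇ {P = _≤ foldr _⊔_ 0ℚ qs}
  (λ p q p⊔q≤m → ≤-trans (p≤p⊔q p q) p⊔q≤m , ≤-trans (p≤q⊔p p q) p⊔q≤m) 0ℚ qs ≤-refl)

[]∈subcollections : ∀ {A : Set} (xs : List A) → [] ∈ subcollections xs
[]∈subcollections []       = here refl
[]∈subcollections (x ∷ xs) = ∈-++⁺ˡ ([]∈subcollections xs)

module _ {P : Problem} where

  -- The singleton of the first item is a feasible subcollection.
  value≤Opt : ∀ (I : Instance P) {i is} → items I ≡ i ∷ is → weight i ≤ capacity I →
    value i ≤ Opt I
  value≤Opt I {i} {is} refl wi≤C = subst (_≤ Opt I) (+-identityʳ (value i))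
    (≤-foldr-⊔ _ (∈-map⁺ totalValue (∈-filter⁺ _
      (∈-++⁺ʳ (subcollections is) (∈-map⁺ (i ∷_) ([]∈subcollections is)))
      (subst (_≤ capacity I) (sym (+-identityʳ (weight i))) wi≤C))))

  -- Equal value and weight are admissible in both problems, so one construction of hard instances
  -- serves both.
  proportionalItem : (q : ℚ) → 0ℚ ≤ q → Item P
  proportionalItem q 0≤q = record
    { value = q ; weight = q ; 0≤value = 0≤q ; 0≤weight = 0≤q ; admissible = adm P }
    where
    adm : ∀ P → Admissible P q q
    adm general      = tt
    adm proportional = refl

  -- Total weights and values.

  totalWeight-++ : (xs ys : List (Item P)) →
    totalWeight (xs ++ ys) ≡ totalWeight xs + totalWeight ys
  totalWeight-++ xs ys =
    trans (cong sumℚ (map-++ weight xs ys)) (sumℚ-++ (map weight xs) (map weight ys))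

  0≤totalWeight : (xs : List (Item P)) → 0ℚ ≤ totalWeight xs
  0≤totalWeight xs = 0≤sumℚ (All.map⁺ (All.universal 0≤weight xs))

  0≤totalValue : (xs : List (Item P)) → 0ℚ ≤ totalValue xs
  0≤totalValue xs = 0≤sumℚ (All.map⁺ (All.universal 0≤value xs))

  weight≤totalWeight : (xs : List (Item P)) → All (λ i → weight i ≤ totalWeight xs) xs
  weight≤totalWeight xs =
    All.map⁻ (All-≤-sumℚ (All.map⁺ (All.universal 0≤weight xs)))

  totalValue≡totalWeight : {xs : List (Item P)} →
    All (λ i → value i ≡ weight i) xs → totalValue xs ≡ totalWeight xs
  totalValue≡totalWeight []         = refl
  totalValue≡totalWeight (eq ∷ eqs) = cong₂ _+_ eq (totalValue≡totalWeight eqs)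

  -- Runs of a packing rule.

  module _ (accept : Rule P) (C : ℚ) where

    packedAfter-All : ∀ {Q : Item P → Set} past {xs} →
      All Q xs → All Q (packedAfter accept C past xs)
    packedAfter-All past [] = []
    packedAfter-All past (_∷_ {x = x} q qs) with accept C past x
    ... | true  = q ∷ packedAfter-All (x ∷ past) qs
    ... | false = packedAfter-All (x ∷ past) qs

    length-packedAfter : ∀ past xs → length (packedAfter accept C past xs) ℕ.≤ length xs
    length-packedAfter past []       = ℕ.z≤n
    length-packedAfter past (x ∷ xs) with accept C past x
    ... | true  = ℕ.s≤s (length-packedAfter (x ∷ past) xs)
    ... | false = ℕ.m≤n⇒m≤1+n (length-packedAfter (x ∷ past) xs)

    -- Decisions on `xs` cannot depend on what arrives later, nor on how much. Hence a rule treats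
    -- an initial run of small items exactly as it treats that run alone.
    packedAfter-++ : ∀ past xs ys → ∃[ past′ ]
      packedAfter accept C past (xs ++ ys) ≡
      packedAfter accept C past xs ++ packedAfter accept C past′ ys
    packedAfter-++ past []       ys = past , refl
    packedAfter-++ past (x ∷ xs) ys
      with past′ , eq ← packedAfter-++ (x ∷ past) xs ys | accept C past x
    ... | true  = past′ , cong (x ∷_) eq
    ... | false = past′ , eq

  -- Expected gain and the additive error term.

  0≤𝔼Alg : (A : Algorithm P) (I : Instance P) → 0ℚ ≤ 𝔼Alg A I
  0≤𝔼Alg A I = 0≤mean (All.map⁺ (All.universal
    (λ xs → 0≤totalValue (packed (accept A) (capacity I) xs)) (arrangements (items I))))

  packedValue : Algorithm P → ℚ → List (Item P) → ℚ
  packedValue A C xs = totalValue (packed (accept A) C xs)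

  -- Competitiveness with the error term absorbed, at the price of a factor `½` and a threshold `M`
  -- on the optimum.
  ½Competitive : Algorithm P → ℕ → ℚ → ℚ → Set
  ½Competitive A n ρ M =
    (I : Instance P) → size I ≡ n → M ≤ Opt I → ½ * Opt I ≤ ρ * 𝔼Alg A I

  -- Sublinearity with `δ = ½` bounds the error by half of the optimum once the optimum is large,
  -- and that half is subtracted from both sides. The error function may change with `n`, and so may
  -- the threshold.
  competitive⇒½Competitive : (A : Algorithm P) {n : ℕ} {ρ : ℚ} → CompetitiveAt A n ρ →
    ∃[ M ] ½Competitive A n ρ M
  competitive⇒½Competitive A {n} {ρ} (g , sublinear , competitive)
    with M , g≤ ← sublinear ½ (positive⁻¹ ½) = M , λ I n≡ M≤Opt →
      let o = Opt I ; e = ρ * 𝔼Alg A I in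
      +-cancelʳ-≤ (½ * o) (½ * o) e (begin
        ½ * o + ½ * o   ≡⟨ solve 1 (λ o → con ½ :* o :+ con ½ :* o := o) refl o ⟩
        o               ≤⟨ competitive I n≡ ⟩
        e + g o         ≤⟨ +-monoʳ-≤ e (≤-trans (p≤∣p∣ (g o)) (g≤ o M≤Opt)) ⟩
        e + ½ * o       ∎)
    where
    open ≤-Reasoning
    p≤∣p∣ : ∀ p → p ≤ ∣ p ∣
    p≤∣p∣ p with ∣p∣≡p∨∣p∣≡-p p
    ... | inj₁ eq = ≤-reflexive (sym eq)
    ... | inj₂ eq with ≤-total 0ℚ p
    ...   | inj₁ 0≤p = ≤-reflexive (sym (0≤p⇒∣p∣≡p 0≤p))
    ...   | inj₂ p≤0 = ≤-trans p≤0 (0≤∣p∣ p)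
    +-cancelʳ-≤ : ∀ r p q → p + r ≤ q + r → p ≤ q
    +-cancelʳ-≤ r p q h = subst₂ _≤_ (lem p) (lem q) (+-monoˡ-≤ (- r) h)
      where
      lem : ∀ p → p + r + - r ≡ p
      lem p = trans (+-assoc p r (- r)) (trans (cong (_+_ p) (+-inverseʳ r)) (+-identityʳ p))

  -- The two families of hard instances.

  module _ (A : Algorithm P) {C : ℚ} (0<C : 0ℚ < C) {x : ℚ} (0<x : 0ℚ < x) where

    small large : Item P
    small = proportionalItem x (<⇒≤ 0<x)
    large = proportionalItem C (<⇒≤ 0<C)

    uniform : ℕ → Instance P
    uniform n = record { capacity = C ; 0<capacity = 0<C ; items = replicate n small }

    -- With `large` listed first, `arrangements` inserts it into arrangements of equal items, so
    -- each block runs through all positions of `large`.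
    mixed : ℕ → Instance P
    mixed k = record { capacity = C ; 0<capacity = 0<C ; items = large ∷ replicate k small }

    -- All arrangements of equal items are the same list, so the behaviour of the deterministic
    -- algorithm on this one list decides the expectation.
    𝔼Alg-uniform≡0 : ∀ n → packed (accept A) C (replicate n small) ≡ [] →
      𝔼Alg A (uniform n) ≡ 0ℚ
    𝔼Alg-uniform≡0 n none = ≤-antisym
      (mean-≤ values ≤-refl (sumℚ-≤ (All.map⁺ (All.map
        (λ { refl → ≤-reflexive (cong totalValue none) })
        (arrangements-replicate n small)))))
      (0≤𝔼Alg A (uniform n))
      where values = map (packedValue A C) (arrangements (replicate n small))

    -- Packing nothing would make the expected gain zero, while the optimum is at least `x`, which
    -- is positive and reaches the threshold. The capacity is arbitrary above `x`, so it can be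
    -- fixed after `x`.
    packs-uniform : ∀ {n ρ M} → x ≤ C → M ≤ x →
      ½Competitive A (suc n) ρ M →
      packed (accept A) C (replicate (suc n) small) ≢ []
    packs-uniform {n} {ρ} {M} x≤C M≤x bound none = <-irrefl refl (begin-strict
      0ℚ             ≡⟨ *-zeroʳ ½ ⟨
      ½ * 0ℚ         <⟨ *-monoʳ-<-pos ½ (<-≤-trans 0<x x≤Opt) ⟩
      ½ * Opt I      ≤⟨ bound I (length-replicate (suc n)) (≤-trans M≤x x≤Opt) ⟩
      ρ * 𝔼Alg A I   ≡⟨ cong (ρ *_) (𝔼Alg-uniform≡0 (suc n) none) ⟩
      ρ * 0ℚ         ≡⟨ *-zeroʳ ρ ⟩
      0ℚ             ∎)
      where
      open ≤-Reasoning
      I = uniform (suc n)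
      x≤Opt = value≤Opt I refl x≤C

    -- Gain on mixed arrival sequences.

    SmallOrLarge : Item P → Set
    SmallOrLarge i = i ≡ small ⊎ i ≡ large

    value≡weight : ∀ {i} → SmallOrLarge i → value i ≡ weight i
    value≡weight (inj₁ refl) = refl
    value≡weight (inj₂ refl) = refl

    packedValue≤C : ∀ {xs} → All SmallOrLarge xs → packedValue A C xs ≤ C
    packedValue≤C {xs} sls = ≤-trans
      (≤-reflexive (totalValue≡totalWeight
        (All.map value≡weight (packedAfter-All (accept A) C [] sls))))
      (feasible A C 0<C xs)

    -- The initial run already puts a small item into the knapsack, which leaves less than `C` for
    -- the rest. So `large` no longer fits, and every packed item is worth at most `x`.
    late≤ : ∀ m {zs} → packed (accept A) C (replicate m small) ≢ [] →
      All SmallOrLarge zs →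
      packedValue A C (replicate m small ++ zs) ≤ ι (m ℕ.+ length zs) * x
    late≤ m {zs} some sls
      with past , split ← packedAfter-++ (accept A) C [] (replicate m small) zs
      = ≤-trans (sumℚ-map-≤ S≤x) (*-monoʳ-≤ (<⇒≤ 0<x) (ι-mono-≤
          (subst (length S ℕ.≤_)
            (trans (length-++ us) (cong (ℕ._+ length zs) (length-replicate m)))
            (length-packedAfter (accept A) C [] (us ++ zs)))))
      where
      us = replicate m small
      S = packed (accept A) C (us ++ zs)
      p = packed (accept A) C us
      q = packedAfter (accept A) C past zs

      p-small : All (_≡ small) p
      p-small = packedAfter-All (accept A) C [] (All.replicate⁺ m refl)

      x≤weight : ∀ {is} → is ≢ [] → All (_≡ small) is → x ≤ totalWeight is
      x≤weight ne []            = ⊥-elim (ne refl)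
      x≤weight _  (_∷_ {xs = is} refl _) = p≤p+q (0≤totalWeight is)

      q<C : totalWeight q < C
      q<C = begin-strict
        totalWeight q                    ≡⟨ +-identityˡ _ ⟨
        0ℚ + totalWeight q               <⟨ +-monoˡ-< (totalWeight q) 0<x ⟩
        x + totalWeight q                ≤⟨ +-monoˡ-≤ (totalWeight q) (x≤weight some p-small) ⟩
        totalWeight p + totalWeight q    ≡⟨ totalWeight-++ p q ⟨
        totalWeight (p ++ q)             ≡⟨ cong totalWeight split ⟨
        totalWeight S                    ≤⟨ feasible A C 0<C (us ++ zs) ⟩
        C                                ∎
        where open ≤-Reasoning

      -- The weight of `large` is the whole capacity `C`, which exceeds the total weight of `q`.
      light : ∀ {i} → weight i ≤ totalWeight q × SmallOrLarge i → value i ≤ x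
      light (_    , inj₁ refl) = ≤-refl
      light (wi≤q , inj₂ refl) = ⊥-elim (<-irrefl refl (≤-<-trans wi≤q q<C))

      S≤x : All (λ i → value i ≤ x) S
      S≤x = subst (All _) (sym split) (All.++⁺
        (All.map (λ { refl → ≤-refl }) p-small)
        (All.map light (All.zip (weight≤totalWeight q , packedAfter-All (accept A) C past sls))))

    -- Of the `n` positions of `large`, the first `m` may each gain up to `C`. The other `j + 1`
    -- gain at most `n * x` each, together at most `C`. This bounds the sum over each block by
    -- `(m + 1) * C`.
    𝔼Alg-mixed≤ : ∀ m j → packed (accept A) C (replicate m small) ≢ [] →
      ι (suc (m ℕ.+ j)) * (ι (suc (m ℕ.+ j)) * x) ≤ C →
      𝔼Alg A (mixed (m ℕ.+ j)) ≤ ι (suc m) * C * (+ 1 / suc (m ℕ.+ j))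
    𝔼Alg-mixed≤ m j some n²x≤C =
      mean-≤ (map f (concatMap (insertions large) arrs)) 0≤β
        (subst (λ l → sumℚ (map f (concatMap (insertions large) arrs)) ≤ ι l * β)
          (sym (length-map f (concatMap (insertions large) arrs)))
          (sumℚ-concatMap-≤ f (insertions large)
            (All.map (λ { refl → block }) (arrangements-replicate k small))))
      where
      k = m ℕ.+ j
      n = suc k
      r = + 1 / n
      β = ι (suc m) * C * r
      f = packedValue A C
      arrs = arrangements (replicate k small)
      us = replicate m small
      vs = replicate j small

      0≤β : 0ℚ ≤ β
      0≤β = subst (_≤ β) (*-zeroˡ r) (*-monoʳ-≤ (<⇒≤ (0<1/suc k))
        (subst (_≤ ι (suc m) * C) (*-zeroʳ (ι (suc m))) (*-monoˡ-≤ (0≤ι (suc m)) (<⇒≤ 0<C))))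

      smalls : ∀ l → All SmallOrLarge (large ∷ replicate l small)
      smalls l = inj₂ refl ∷ All.replicate⁺ l (inj₁ refl)

      insertions-SmallOrLarge : ∀ l → All (All SmallOrLarge) (insertions large (replicate l small))
      insertions-SmallOrLarge l = All.map (λ σ → All-resp-↭ (↭-sym σ) (smalls l))
        (insertions-↭ large (replicate l small))

      early : All (λ zs → f zs ≤ C) (insertions large (us ++ vs))
      early = subst (λ ys → All (λ zs → f zs ≤ C) (insertions large ys)) (replicate-+ m j small)
        (All.map packedValue≤C (insertions-SmallOrLarge k))

      late : All (λ zs → f (us ++ zs) ≤ ι n * x) (insertions large vs)
      late = All.map
        (λ { {zs} (σ , sls) → subst (λ l → f (us ++ zs) ≤ ι l * x)
          (trans (cong (m ℕ.+_) (trans (↭-length σ) (cong suc (length-replicate j)))) (ℕ.+-suc m j))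
          (late≤ m some sls) })
        (All.zip (insertions-↭ large vs , insertions-SmallOrLarge j))

      block : sumℚ (map f (insertions large (replicate k small))) ≤
              ι (length (insertions large (replicate k small))) * β
      block = begin
        sumℚ (map f (insertions large (replicate k small)))
          ≡⟨ cong (sumℚ ∘ map f ∘ insertions large) (replicate-+ m j small) ⟩
        sumℚ (map f (insertions large (us ++ vs)))
          ≤⟨ sumℚ-insertions-≤ f us vs early late ⟩
        ι (length us) * C + ι (suc (length vs)) * (ι n * x)
          ≡⟨ cong₂ (λ a b → ι a * C + ι (suc b) * (ι n * x))
               (length-replicate m) (length-replicate j) ⟩
        ι m * C + ι (suc j) * (ι n * x)
          -- Since `j + 1 ≤ n`, the late positions contribute at most `n * (n * x) ≤ C`.
          ≤⟨ +-monoʳ-≤ (ι m * C) (≤-trans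
               (*-monoʳ-≤ 0≤nx (ι-mono-≤ (ℕ.s≤s (ℕ.m≤n+m j m)))) n²x≤C) ⟩
        ι m * C + C
          ≡⟨ +-comm (ι m * C) C ⟩
        C + ι m * C
          ≡⟨ ι-suc-* m C ⟨
        ι (suc m) * C
          ≡⟨ *-identityʳ _ ⟨
        ι (suc m) * C * 1ℚ
          ≡⟨ cong (ι (suc m) * C *_) (ι-*-inverse k) ⟨
        ι (suc m) * C * (ι n * r)
          ≡⟨ solve 3 (λ a i r → a :* (i :* r) := i :* (a :* r)) refl (ι (suc m) * C) (ι n) r ⟩
        ι n * β
          ≡⟨ cong (λ l → ι l * β) (trans (length-insertions large (replicate k small))
               (cong suc (length-replicate k))) ⟨
        ι (length (insertions large (replicate k small))) * β ∎
        where
        open ≤-Reasoning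
        0≤nx : 0ℚ ≤ ι n * x
        0≤nx = subst (_≤ ι n * x) (*-zeroʳ (ι n)) (*-monoˡ-≤ (0≤ι n) (<⇒≤ 0<x))

    -- The item `large` alone gives an optimum of at least `C`, to be compared with the expected
    -- gain of at most `(m + 1) * C / n`; then `C` cancels.
    ½n≤[1+m]ρ : ∀ m j {ρ M} → packed (accept A) C (replicate m small) ≢ [] →
      ι (suc (m ℕ.+ j)) * (ι (suc (m ℕ.+ j)) * x) ≤ C → M ≤ C →
      ½Competitive A (suc (m ℕ.+ j)) ρ M →
      ½ * ι (suc (m ℕ.+ j)) ≤ ρ * ι (suc m)
    ½n≤[1+m]ρ m j {ρ} some n²x≤C M≤C bound = *-cancelʳ-≤-pos C {{positive 0<C}} (begin
      ½ * ι n * C                       ≡⟨ solve 3 (λ h i c → h :* i :* c := (h :* c) :* i) refl ½ (ι n) C ⟩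
      ½ * C * ι n                       ≤⟨ *-monoʳ-≤ (0≤ι n) ½C≤ρβ ⟩
      ρ * (ι (suc m) * C * r) * ι n     ≡⟨ solve 5 (λ ρ i c r n → ρ :* (i :* c :* r) :* n := (ρ :* i :* c) :* (n :* r))
                                             refl ρ (ι (suc m)) C r (ι n) ⟩
      ρ * ι (suc m) * C * (ι n * r)     ≡⟨ cong (ρ * ι (suc m) * C *_) (ι-*-inverse k) ⟩
      ρ * ι (suc m) * C * 1ℚ            ≡⟨ *-identityʳ _ ⟩
      ρ * ι (suc m) * C                 ∎)
      where
      open ≤-Reasoning
      k = m ℕ.+ j
      n = suc k
      r = + 1 / n
      I = mixed k

      C≤Opt : C ≤ Opt I
      C≤Opt = value≤Opt I refl ≤-refl

      ½C≤ρE : ½ * C ≤ ρ * 𝔼Alg A I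
      ½C≤ρE = ≤-trans (*-monoˡ-≤-nonNeg ½ C≤Opt)
        (bound I (cong suc (length-replicate k)) (≤-trans M≤C C≤Opt))

      ½C≤ρβ : ½ * C ≤ ρ * (ι (suc m) * C * r)
      -- Multiplying the bound on the expected gain by `ρ` requires `0ℚ ≤ ρ`. If `ρ ≤ 0ℚ`, then
      -- `ρ * 𝔼Alg A I` is at most zero and cannot reach `½ * C`.
      ½C≤ρβ with ≤-total 0ℚ ρ
      ... | inj₁ 0≤ρ = ≤-trans ½C≤ρE (*-monoˡ-≤ 0≤ρ (𝔼Alg-mixed≤ m j some n²x≤C))
      ... | inj₂ ρ≤0 = ⊥-elim (<-irrefl refl (begin-strict
        0ℚ             ≡⟨ *-zeroʳ ½ ⟨
        ½ * 0ℚ         <⟨ *-monoʳ-<-pos ½ 0<C ⟩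
        ½ * C          ≤⟨ ½C≤ρE ⟩
        ρ * 𝔼Alg A I   ≤⟨ *-monoʳ-≤ (0≤𝔼Alg A I) ρ≤0 ⟩
        0ℚ * 𝔼Alg A I  ≡⟨ *-zeroˡ (𝔼Alg A I) ⟩
        0ℚ             ∎))

-- Choice of parameters and the asymptotic bound.

theorem26 : (P : Problem) (A : Algorithm P) (ρ : ℕ → ℚ) →
    HasCompetitiveRatio A ρ →
    ρ ∈Ω (λ n → + n / 1)
theorem26 P A ρ (n₀ , competitive) = ½ * r , 0<½r , suc m , linear
  where
  -- Competitiveness applies at length `m`, and `m` is positive, so the uniform instance has a first
  -- item.
  m = suc n₀
  r = + 1 / suc m

  threshold : ∀ n → n₀ ℕ.≤ n → ℚ
  threshold n n₀≤n = proj₁ (competitive⇒½Competitive A {n} {ρ n} (competitive n n₀≤n))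

  bound : ∀ n (n₀≤n : n₀ ℕ.≤ n) → ½Competitive A n (ρ n) (threshold n n₀≤n)
  bound n n₀≤n = proj₂ (competitive⇒½Competitive A {n} {ρ n} (competitive n n₀≤n))

  n₀≤m : n₀ ℕ.≤ m
  n₀≤m = ℕ.n≤1+n n₀

  0<½r : 0ℚ < ½ * r
  0<½r = subst (_< ½ * r) (*-zeroʳ ½) (*-monoʳ-<-pos ½ (0<1/suc m))

  -- The threshold at length `m` forces a small item to be packed; `1ℚ` makes `x` positive. This
  -- choice does not depend on `n`.
  x = threshold m n₀≤m ⊔ 1ℚ

  0<x : 0ℚ < x
  0<x = <-≤-trans (positive⁻¹ 1ℚ) (p≤q⊔p (threshold m n₀≤m) 1ℚ)

  q≤ιsuc*q : ∀ n {q} → 0ℚ ≤ q → q ≤ ι (suc n) * q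
  q≤ιsuc*q n {q} 0≤q =
    subst (_≤ ι (suc n) * q) (*-identityˡ q) (*-monoʳ-≤ 0≤q (ι-mono-≤ (ℕ.s≤s (ℕ.z≤n {n}))))

  ½n≤ : ∀ j → ½ * ι (suc (m ℕ.+ j)) ≤ ρ (suc (m ℕ.+ j)) * ι (suc m)
  ½n≤ j = ½n≤[1+m]ρ A 0<C 0<x m j {ρ n}
    (packs-uniform A 0<C 0<x {n₀} {ρ m} x≤C (p≤p⊔q (threshold m n₀≤m) 1ℚ) (bound m n₀≤m))
    (p≤p⊔q n²x M) (p≤q⊔p n²x M) (bound n n₀≤n)
    where
    n = suc (m ℕ.+ j)

    n₀≤n : n₀ ℕ.≤ n
    n₀≤n = ℕ.≤-trans (ℕ.m≤n+m n₀ 2) (ℕ.m≤m+n (suc m) j)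

    M = threshold n n₀≤n
    n²x = ι n * (ι n * x)
    -- The first term keeps the late gains small; the second lifts the optimum above the threshold
    -- at length `n`.
    C = n²x ⊔ M

    x≤nx : x ≤ ι n * x
    x≤nx = q≤ιsuc*q (m ℕ.+ j) (<⇒≤ 0<x)

    x≤C : x ≤ C
    x≤C = ≤-trans (≤-trans x≤nx (q≤ιsuc*q (m ℕ.+ j) (≤-trans (<⇒≤ 0<x) x≤nx))) (p≤p⊔q n²x M)

    0<C : 0ℚ < C
    0<C = <-≤-trans 0<x x≤C

  linear : ∀ n → suc m ℕ.≤ n → ½ * r * ι n ≤ ρ n
  linear n m<n with j , refl ← ℕ.m≤n⇒∃[o]m+o≡n m<n = begin
    ½ * r * ι n            ≡⟨ solve 3 (λ h r i → h :* r :* i := (h :* i) :* r) refl ½ r (ι n) ⟩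
    ½ * ι n * r            ≤⟨ *-monoʳ-≤ (<⇒≤ (0<1/suc m)) (½n≤ j) ⟩
    ρ n * ι (suc m) * r    ≡⟨ *-assoc (ρ n) (ι (suc m)) r ⟩
    ρ n * (ι (suc m) * r)  ≡⟨ cong (ρ n *_) (ι-*-inverse m) ⟩
    ρ n * 1ℚ               ≡⟨ *-identityʳ (ρ n) ⟩
    ρ n                    ∎
    where open ≤-Reasoning
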